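{- For all $d\ge 3$, the maximal number $f(d)$ of facets of a $d$-dimensional edge polytope of a connected graph satisfies \[ 4^{\lfloor d/3\rfloor}<f(d)\le 2^d+d. \]
   Context: All graphs are finite, undirected, without loops, multiple edges or isolated vertices. For a graph $G$ on vertex set $[n]$, the edge polytope is $\mathcal{P}(G)=\mathrm{conv}\{e_i+e_j : \{i,j\}\in E(G)\}\subseteq\mathbb{R}^n$. $f(d)$ denotes the maximum number of facets of $\mathcal{P}(G)$ over all connected graphs $G$ with $\dim(\mathcal{P}(G))=d$.
   Formalization: The edge polytope is taken in rational instead of real n-space: facets are given by inequalities with rational coefficients and affine dimension is over the rationals; as the vertices are integral, dimension and facets are the same as over the reals. -}

module Defs where

open import Data.Nat using (ℕ; zero; suc; _∸_)
open import Data.Fin using (Fin; zero; suc; _≟_)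
open import Data.Bool using (Bool; true; false)
open import Data.Product using (Σ; ∃; _×_; _,_; proj₁; proj₂)
open import Data.Rational using (ℚ; 0ℚ; 1ℚ; _+_; _*_; _≤_; _<_)
open import Data.List using (List)
open import Data.List.Relation.Unary.AllPairs using (AllPairs)
open import Relation.Nullary using (¬_; yes; no)
open import Relation.Binary.PropositionalEquality using (_≡_)
open import Function.Bundles using (_⇔_)

record Graph (n : ℕ) : Set where
  field
    adj        : Fin n → Fin n → Bool
    symmetric  : ∀ i j → adj i j ≡ adj j i
    loopless   : ∀ i → adj i i ≡ false
    noIsolated : ∀ i → ∃ λ j → adj i j ≡ true
open Graph public

data Reach {n : ℕ} (G : Graph n) : Fin n → Fin n → Set where
  here : ∀ {i} → Reach G i i
  step : ∀ {i j k} → adj G i j ≡ true → Reach G j k → Reach G i k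

Connected : {n : ℕ} → Graph n → Set
Connected G = ∀ i j → Reach G i j

-- An edge {i,j}, given as an ordered pair with adj i j (each unordered edge
-- appears twice, as (i,j) and (j,i); both give the same point e_i + e_j).
Edge : {n : ℕ} → Graph n → Set
Edge {n} G = Σ (Fin n × Fin n) λ p → adj G (proj₁ p) (proj₂ p) ≡ true

Point : ℕ → Set
Point n = Fin n → ℚ

indicator : {n : ℕ} → Fin n → Point n
indicator i k with i ≟ k
... | yes _ = 1ℚ
... | no  _ = 0ℚ

edgePoint : {n : ℕ} {G : Graph n} → Edge G → Point n
edgePoint ((i , j) , _) k = indicator i k + indicator j k

sumFin : (m : ℕ) → (Fin m → ℚ) → ℚ
sumFin zero    f = 0ℚ
sumFin (suc m) f = f zero + sumFin m (λ t → f (suc t))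

AffinelyIndependent : {n m : ℕ} → (Fin m → Point n) → Set
AffinelyIndependent {n} {m} p =
  ∀ (λ' : Fin m → ℚ) →
    sumFin m λ' ≡ 0ℚ →
    (∀ k → sumFin m (λ t → λ' t * p t k) ≡ 0ℚ) →
    ∀ t → λ' t ≡ 0ℚ

-- The convex hull of the edge points lying in S has affine dimension k:
-- S contains k+1 affinely independent edge points, but not k+2.
-- (The dimension of conv(X) is the dimension of the affine hull of X.)
HasDim : {n : ℕ} {G : Graph n} → (Edge G → Set) → ℕ → Set
HasDim {n} {G} S k =
  (Σ (Fin (suc k) → Edge G) λ p →
      (∀ t → S (p t)) × AffinelyIndependent (λ t → edgePoint {G = G} (p t)))
  × ¬ (Σ (Fin (suc (suc k)) → Edge G) λ p →
      (∀ t → S (p t)) × AffinelyIndependent (λ t → edgePoint {G = G} (p t)))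

All : {n : ℕ} {G : Graph n} → Edge G → Set
All _ = Data.Unit.⊤
  where import Data.Unit

EdgePolytopeDim : {n : ℕ} → Graph n → ℕ → Set
EdgePolytopeDim G d = HasDim {G = G} (All {G = G}) d

dot : {n : ℕ} → Point n → Point n → ℚ
dot {n} a x = sumFin n (λ k → a k * x k)

-- A facet of P(G) (where dim P(G) = d), presented by a valid inequality
-- a·x ≤ b whose face {x ∈ P(G) : a·x = b} has dimension d - 1.
-- The face is the convex hull of the tight vertices.
record Facet {n : ℕ} (G : Graph n) (d : ℕ) : Set where
  field
    a     : Point n
    b     : ℚ
    valid : ∀ (e : Edge G) → dot a (edgePoint {G = G} e) ≤ b
    facetDim : HasDim {G = G} (λ e → dot a (edgePoint {G = G} e) ≡ b) (d ∸ 1)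
open Facet public

Tight : {n d : ℕ} {G : Graph n} → Facet G d → Edge G → Set
Tight {G = G} F e = dot (a F) (edgePoint {G = G} e) ≡ b F

-- Two presentations give the same facet iff they have the same set of
-- vertices (a face is the convex hull of its vertices).
SameFacet : {n d : ℕ} {G : Graph n} → Facet G d → Facet G d → Set
SameFacet {G = G} F F' = ∀ (e : Edge G) → Tight F e ⇔ Tight F' e

DistinctFacets : {n d : ℕ} {G : Graph n} → List (Facet G d) → Set
DistinctFacets = AllPairs (λ F F' → ¬ SameFacet F F')

{-# OPTIONS --safe #-}

-- Upper bound. For a facet a·x ≤ b put c i = b/2 − a i, so that c i + c j ≥ 0 on
-- edges, with equality on the edges of the facet. These tight edges have rank d,
-- so c is determined up to scaling when G has d + 1 vertices (G not bipartite),
-- and after subtracting a multiple of the bipartition functional to get c 0 = 0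
-- when it has d + 2 (G bipartite). Erasing entries of c that the tight
-- edges do not link to the others shows that c is a multiple of 1_N − 1_T, where
-- either T is a nonempty independent set and N its neighbourhood, or T is empty
-- and N is a single vertex. At most d + 1 facets have T empty. At most 2^d − 1 have T
-- nonempty: in the non-bipartite case T is recovered from the partition {T, Tᶜ}, as T
-- and Tᶜ are not both independent; in the bipartite case T avoids 0 and a
-- neighbour of 0.
--
-- Lower bound. Glue ⌊d/3⌋ copies of K₄ at a hub and attach d mod 3 pendant edges
-- to it. Choosing at most one non-hub vertex in each K₄, together with all
-- pendant vertices, gives 4^⌊d/3⌋ choices of T with N ∋ hub defining distinct
-- facets, and T = {hub} gives another one.
module Submission where

open import Defs
open import Data.Bool using (Bool; true; false; not; _∧_; _xor_; if_then_else_)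
import Data.Bool.Properties as 𝔹ₚ
open import Data.Fin as Fin using (Fin; zero; suc; punchIn; punchOut; join; splitAt; combine; remQuot;
  _↑ˡ_; _↑ʳ_; funToFin; finToFun; _≟_)
open import Data.Fin.Properties using (any?; punchIn-punchOut; punchOut-injective; pigeonhole;
  splitAt-join; join-splitAt; splitAt-↑ˡ; splitAt-↑ʳ; remQuot-combine; combine-remQuot;
  finToFun-funToFin; funToFin-finToFin)
import Data.Integer as ℤ
open import Data.List using (List; length; lookup; tabulate; _∷_)
open import Data.List.Membership.Propositional.Properties using (∈-lookup)
open import Data.List.Properties using (length-tabulate)
import Data.List.Relation.Unary.All as All
import Data.List.Relation.Unary.All.Properties as Allₚ
open import Data.List.Relation.Unary.AllPairs as AllPairs using (AllPairs)
open import Data.List.Relation.Unary.AllPairs.Properties using (tabulate⁺)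
open import Data.Nat as ℕ using (ℕ; zero; suc; _≤_; _<_; _+_; _^_; _/_; _%_; z≤n; s≤s)
open import Data.Nat.DivMod using (m≡m%n+[m/n]*n; m≥n⇒m/n>0)
import Data.Nat.Properties as ℕₚ
open import Data.Product using (Σ; ∃; _×_; _,_; proj₁; proj₂; uncurry)
open import Data.Rational as ℚ using (ℚ; 0ℚ; 1ℚ; ½; 1/_; ∣_∣)
import Data.Rational.Properties as ℚₚ
open import Data.Rational.Solver using (module +-*-Solver)
open import Data.Sum using (_⊎_; inj₁; inj₂; [_,_]′)
open import Data.Sum.Properties using (inj₁-injective; inj₂-injective)
open import Data.Unit using (⊤; tt)
open import Data.Vec.Functional using () renaming (_∷_ to _∷ᵛ_)
open import Function using (_∘_)
open import Function.Bundles using (_⇔_; mk⇔; Equivalence)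
open import Relation.Binary.PropositionalEquality
open import Relation.Nullary using (¬_; Dec; yes; no; does; contradiction)
open import Relation.Nullary.Decidable using (¬?; decidable-stable; _×-dec_)

open import Algebra.Properties.Group ℚₚ.+-0-group using (inverseˡ-unique; ⁻¹-involutive; x∙y⁻¹≈ε⇒x≈y)
open +-*-Solver using (solve; _:+_; _:*_; :-_; _:=_; con)

-- Linear algebra over ℚ

sum-cong : ∀ {m} {f g : Fin m → ℚ} → (∀ t → f t ≡ g t) → sumFin m f ≡ sumFin m g
sum-cong {zero}  f≗g = refl
sum-cong {suc m} f≗g = cong₂ ℚ._+_ (f≗g zero) (sum-cong (f≗g ∘ suc))

sum-zero : ∀ {m} {f : Fin m → ℚ} → (∀ t → f t ≡ 0ℚ) → sumFin m f ≡ 0ℚ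
sum-zero {zero}  f≗0 = refl
sum-zero {suc m} f≗0 = cong₂ ℚ._+_ (f≗0 zero) (sum-zero (f≗0 ∘ suc))

sum-+ : ∀ {m} (f g : Fin m → ℚ) →
        sumFin m (λ t → f t ℚ.+ g t) ≡ sumFin m f ℚ.+ sumFin m g
sum-+ {zero}  f g = refl
sum-+ {suc m} f g = trans (cong (f zero ℚ.+ g zero ℚ.+_) (sum-+ (f ∘ suc) (g ∘ suc)))
  (solve 4 (λ a b c d → (a :+ b) :+ (c :+ d) := (a :+ c) :+ (b :+ d)) refl
     (f zero) (g zero) (sumFin m (f ∘ suc)) (sumFin m (g ∘ suc)))

sum-*ˡ : ∀ {m} q (f : Fin m → ℚ) → sumFin m (λ t → q ℚ.* f t) ≡ q ℚ.* sumFin m f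
sum-*ˡ {zero}  q f = sym (ℚₚ.*-zeroʳ q)
sum-*ˡ {suc m} q f = trans (cong (q ℚ.* f zero ℚ.+_) (sum-*ˡ q (f ∘ suc)))
  (sym (ℚₚ.*-distribˡ-+ q (f zero) (sumFin m (f ∘ suc))))

sum-swap : ∀ {m n} (f : Fin m → Fin n → ℚ) →
           sumFin m (λ i → sumFin n (f i)) ≡ sumFin n (λ j → sumFin m (λ i → f i j))
sum-swap {zero}  {n} f = sym (sum-zero {n} λ _ → refl)
sum-swap {suc m} {n} f = trans (cong (sumFin n (f zero) ℚ.+_) (sum-swap (f ∘ suc)))
  (sym (sum-+ (f zero) (λ j → sumFin m (λ i → f (suc i) j))))

dot-comm : ∀ {n} (x y : Point n) → dot x y ≡ dot y x
dot-comm x y = sum-cong λ k → ℚₚ.*-comm (x k) (y k)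

dot-linear : ∀ {n} (x y z : Point n) q →
             dot x (λ k → y k ℚ.+ q ℚ.* z k) ≡ dot x y ℚ.+ q ℚ.* dot x z
dot-linear x y z q = trans
  (sum-cong λ k → solve 4 (λ a b c d → a :* (b :+ c :* d) := a :* b :+ c :* (a :* d)) refl
                    (x k) (y k) q (z k))
  (trans (sum-+ (λ k → x k ℚ.* y k) (λ k → q ℚ.* (x k ℚ.* z k)))
         (cong (dot x y ℚ.+_) (sum-*ˡ q (λ k → x k ℚ.* z k))))

combination : ∀ {m n} → (Fin m → ℚ) → (Fin m → Point n) → Point n
combination {m} c w k = sumFin m (λ t → c t ℚ.* w t k)

dot-combination : ∀ {m n} (x : Point n) c (w : Fin m → Point n) →
                  dot x (combination c w) ≡ dot c (λ t → dot x (w t))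
dot-combination {m} {n} x c w = begin
  sumFin n (λ k → x k ℚ.* sumFin m (λ t → c t ℚ.* w t k))
    ≡⟨ sum-cong (λ k → sum-*ˡ (x k) (λ t → c t ℚ.* w t k)) ⟨
  sumFin n (λ k → sumFin m (λ t → x k ℚ.* (c t ℚ.* w t k)))
    ≡⟨ sum-swap (λ k t → x k ℚ.* (c t ℚ.* w t k)) ⟩
  sumFin m (λ t → sumFin n (λ k → x k ℚ.* (c t ℚ.* w t k)))
    ≡⟨ sum-cong (λ t → sum-cong λ k →
         solve 3 (λ a b c → a :* (b :* c) := b :* (a :* c)) refl (x k) (c t) (w t k)) ⟩
  sumFin m (λ t → sumFin n (λ k → c t ℚ.* (x k ℚ.* w t k)))
    ≡⟨ sum-cong (λ t → sum-*ˡ (c t) (λ k → x k ℚ.* w t k)) ⟩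
  sumFin m (λ t → c t ℚ.* dot x (w t)) ∎
  where open ≡-Reasoning

indicator-refl : ∀ {n} (i : Fin n) → indicator i i ≡ 1ℚ
indicator-refl i with i ≟ i
... | yes _  = refl
... | no i≢i = contradiction refl i≢i

indicator-≢ : ∀ {n} (i k : Fin n) → i ≢ k → indicator i k ≡ 0ℚ
indicator-≢ i k i≢k with i ≟ k
... | yes i≡k = contradiction i≡k i≢k
... | no _    = refl

indicator-suc : ∀ {n} (i k : Fin n) → indicator (suc i) (suc k) ≡ indicator i k
indicator-suc i k with i ≟ k
... | yes _ = refl
... | no  _ = refl

dot-indicator : ∀ {n} (x : Point n) i → dot x (indicator i) ≡ x i
dot-indicator {suc n} x zero = begin
  x zero ℚ.* 1ℚ ℚ.+ sumFin n (λ k → x (suc k) ℚ.* 0ℚ)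
    ≡⟨ cong₂ ℚ._+_ (ℚₚ.*-identityʳ (x zero)) (sum-zero (λ k → ℚₚ.*-zeroʳ (x (suc k)))) ⟩
  x zero ℚ.+ 0ℚ ≡⟨ ℚₚ.+-identityʳ (x zero) ⟩
  x zero ∎
  where open ≡-Reasoning
dot-indicator {suc n} x (suc i) = begin
  x zero ℚ.* 0ℚ ℚ.+ sumFin n (λ k → x (suc k) ℚ.* indicator (suc i) (suc k))
    ≡⟨ cong₂ ℚ._+_ (ℚₚ.*-zeroʳ (x zero))
         (sum-cong λ k → cong (x (suc k) ℚ.*_) (indicator-suc i k)) ⟩
  0ℚ ℚ.+ dot (x ∘ suc) (indicator i) ≡⟨ ℚₚ.+-identityˡ _ ⟩
  dot (x ∘ suc) (indicator i)        ≡⟨ dot-indicator (x ∘ suc) i ⟩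
  x (suc i) ∎
  where open ≡-Reasoning

p*q≡0⇒p≡0 : ∀ p q → q ≢ 0ℚ → p ℚ.* q ≡ 0ℚ → p ≡ 0ℚ
p*q≡0⇒p≡0 p q q≢0 pq≡0 = begin
  p                    ≡⟨ ℚₚ.*-identityʳ p ⟨
  p ℚ.* 1ℚ             ≡⟨ cong (p ℚ.*_) (ℚₚ.*-inverseʳ q) ⟨
  p ℚ.* (q ℚ.* 1/ q)   ≡⟨ ℚₚ.*-assoc p q (1/ q) ⟨
  p ℚ.* q ℚ.* 1/ q     ≡⟨ cong (ℚ._* 1/ q) pq≡0 ⟩
  0ℚ ℚ.* 1/ q          ≡⟨ ℚₚ.*-zeroˡ (1/ q) ⟩
  0ℚ ∎
  where
  open ≡-Reasoning
  instance _ = ℚ.≢-nonZero q≢0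

-- Gaussian elimination of the first unknown.
nontrivialSolution : ∀ {r s} → r < s → (A : Fin r → Point s) →
  ∃ λ x → (∃ λ j → x j ≢ 0ℚ) × (∀ i → dot x (A i) ≡ 0ℚ)
nontrivialSolution {r} {suc s} r<s A with any? (λ i → ¬? (A i zero ℚₚ.≟ 0ℚ))
... | no  all-zero = indicator zero , (zero , λ ()) , λ i →
  trans (dot-comm (indicator zero) (A i)) (trans (dot-indicator (A i) zero)
    (decidable-stable (A i zero ℚₚ.≟ 0ℚ) λ ≢0 → all-zero (i , ≢0)))
nontrivialSolution {suc r} {suc s} (s≤s r<s) A | yes (i , p≢0) =
  x , (suc j , yj≢0) , λ l → row l (i ≟ l)
  where
  instance _ = ℚ.≢-nonZero p≢0
  p = A i zero
  u = 1/ p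
  B : Fin r → Point s
  B l k = A (punchIn i l) (suc k) ℚ.+ ℚ.- (A (punchIn i l) zero ℚ.* u) ℚ.* A i (suc k)
  rec = nontrivialSolution r<s B
  y = proj₁ rec
  j = proj₁ (proj₁ (proj₂ rec))
  yj≢0 = proj₂ (proj₁ (proj₂ rec))
  S : Fin (suc r) → ℚ
  S l = dot y (A l ∘ suc)
  x : Point (suc s)
  x = ℚ.- (S i ℚ.* u) ∷ᵛ y
  open ≡-Reasoning
  reduced : ∀ l → S (punchIn i l) ℚ.+ ℚ.- (A (punchIn i l) zero ℚ.* u) ℚ.* S i ≡ 0ℚ
  reduced l = trans (sym (dot-linear y (A (punchIn i l) ∘ suc) (A i ∘ suc) (ℚ.- (A (punchIn i l) zero ℚ.* u))))
                    (proj₂ (proj₂ rec) l)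
  row : ∀ l → Dec (i ≡ l) → dot x (A l) ≡ 0ℚ
  row l (yes refl) = begin
    ℚ.- (S i ℚ.* u) ℚ.* p ℚ.+ S i
      ≡⟨ solve 3 (λ s u p → :- (s :* u) :* p :+ s := s :* (con 1ℚ :+ :- (p :* u))) refl (S i) u p ⟩
    S i ℚ.* (1ℚ ℚ.+ ℚ.- (p ℚ.* u)) ≡⟨ cong (λ z → S i ℚ.* (1ℚ ℚ.+ ℚ.- z)) (ℚₚ.*-inverseʳ p) ⟩
    S i ℚ.* 0ℚ                     ≡⟨ ℚₚ.*-zeroʳ (S i) ⟩
    0ℚ ∎
  row l (no i≢l) = subst (λ l → dot x (A l) ≡ 0ℚ) (punchIn-punchOut i≢l) (begin
    ℚ.- (S i ℚ.* u) ℚ.* A l′ zero ℚ.+ S l′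
      ≡⟨ solve 4 (λ s u a s′ → :- (s :* u) :* a :+ s′ := s′ :+ :- (a :* u) :* s) refl
           (S i) u (A l′ zero) (S l′) ⟩
    S l′ ℚ.+ ℚ.- (A l′ zero ℚ.* u) ℚ.* S i ≡⟨ reduced (punchOut i≢l) ⟩
    0ℚ ∎)
    where l′ = punchIn i (punchOut i≢l)

Independent : ∀ {m n} → (Fin m → Point n) → Set
Independent w = ∀ c → (∀ k → combination c w k ≡ 0ℚ) → ∀ t → c t ≡ 0ℚ

-- The coefficients of a relation solve a homogeneous system with one equation per coordinate, so
-- more than `n` of them would leave a nonzero solution.
independent⇒≤ : ∀ {m n} (w : Fin m → Point n) → Independent w → m ≤ n
independent⇒≤ {m} {n} w ind = ℕₚ.≮⇒≥ λ n<m →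
  let c , (t , ct≢0) , c⊥ = nontrivialSolution n<m (λ k t → w t k)
  in ct≢0 (ind c c⊥ t)

-- Pairing a relation with `x` kills every term but the first, which leaves `c zero` times `dot x y`
-- equal to zero.
independent-∷ : ∀ {m n} (w : Fin m → Point n) (x y : Point n) → Independent w →
                (∀ t → dot x (w t) ≡ 0ℚ) → dot x y ≢ 0ℚ → Independent (y ∷ᵛ w)
independent-∷ w x y ind x⊥w xy≢0 c comb≡0 =
  λ { zero → c₀≡0 ; (suc t) → ind (c ∘ suc) tail≡0 t }
  where
  open ≡-Reasoning
  c₀≡0 : c zero ≡ 0ℚ
  c₀≡0 = p*q≡0⇒p≡0 (c zero) (dot x y) xy≢0 (begin
    c zero ℚ.* dot x y          ≡⟨ ℚₚ.+-identityʳ _ ⟨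
    c zero ℚ.* dot x y ℚ.+ 0ℚ   ≡⟨ cong (c zero ℚ.* dot x y ℚ.+_) (sum-zero λ t →
                                     trans (cong (c (suc t) ℚ.*_) (x⊥w t)) (ℚₚ.*-zeroʳ (c (suc t)))) ⟨
    dot c (λ t → dot x ((y ∷ᵛ w) t))  ≡⟨ dot-combination x c (y ∷ᵛ w) ⟨
    dot x (combination c (y ∷ᵛ w)) ≡⟨ sum-zero (λ k → trans (cong (x k ℚ.*_) (comb≡0 k)) (ℚₚ.*-zeroʳ (x k))) ⟩
    0ℚ ∎)
  tail≡0 : ∀ k → combination (c ∘ suc) w k ≡ 0ℚ
  tail≡0 k = begin
    combination (c ∘ suc) w k          ≡⟨ ℚₚ.+-identityˡ _ ⟨
    0ℚ ℚ.+ combination (c ∘ suc) w k   ≡⟨ cong (ℚ._+ combination (c ∘ suc) w k)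
                                            (trans (cong (ℚ._* y k) c₀≡0) (ℚₚ.*-zeroˡ (y k))) ⟨
    combination c (y ∷ᵛ w) k            ≡⟨ comb≡0 k ⟩
    0ℚ ∎

-- If `x k` were nonzero, `indicator k` could be adjoined to `w`, giving more than `n` independent
-- vectors.
independent-basis : ∀ {m n} (w : Fin m → Point n) → n ≤ m → Independent w →
                    (x : Point n) → (∀ t → dot x (w t) ≡ 0ℚ) → ∀ k → x k ≡ 0ℚ
independent-basis w n≤m ind x x⊥w k = decidable-stable (x k ℚₚ.≟ 0ℚ) λ xk≢0 →
  ℕₚ.<⇒≱ (s≤s n≤m) (independent⇒≤ (indicator k ∷ᵛ w)
    (independent-∷ w x (indicator k) ind x⊥w (xk≢0 ∘ trans (sym (dot-indicator x k)))))

-- The orthogonal complement of `w` is the line through `c`. As `c` does not vanish at `k`,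
-- adjoining `indicator k` completes `w` to a basis.
orthogonal-line : ∀ {m n} (w : Fin m → Point n) → n ≤ suc m → Independent w →
                  (c : Point n) → (∀ t → dot c (w t) ≡ 0ℚ) → ∀ k → c k ≢ 0ℚ →
                  (x : Point n) → (∀ t → dot x (w t) ≡ 0ℚ) → x k ≡ 0ℚ → ∀ l → x l ≡ 0ℚ
orthogonal-line w n≤ ind c c⊥w k ck≢0 x x⊥w xk≡0 =
  independent-basis (indicator k ∷ᵛ w) n≤
    (independent-∷ w c (indicator k) ind c⊥w (ck≢0 ∘ trans (sym (dot-indicator c k)))) x
    λ { zero → trans (dot-indicator x k) xk≡0 ; (suc t) → x⊥w t }

-- Edge points

module _ {n} {G : Graph n} where

  dot-edge : ∀ (x : Point n) (e : Edge G) →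
             dot x (edgePoint {G = G} e) ≡ x (proj₁ (proj₁ e)) ℚ.+ x (proj₂ (proj₁ e))
  dot-edge x ((i , j) , _) = trans
    (sum-cong λ k → ℚₚ.*-distribˡ-+ (x k) (indicator i k) (indicator j k))
    (trans (sum-+ (λ k → x k ℚ.* indicator i k) (λ k → x k ℚ.* indicator j k))
           (cong₂ ℚ._+_ (dot-indicator x i) (dot-indicator x j)))

  points : ∀ {m} → (Fin m → Edge G) → Fin m → Point n
  points p t = edgePoint {G = G} (p t)

  -- Edge points lie on the hyperplane Σ x = 2, which misses the origin.
  affine⇒independent : ∀ {m} (p : Fin m → Edge G) →
                       AffinelyIndependent (points p) → Independent (points p)
  affine⇒independent {m} p aff c comb≡0 = aff c Σc≡0 comb≡0
    where
    open ≡-Reasoning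
    one : Point n
    one _ = 1ℚ
    Σc≡0 : sumFin m c ≡ 0ℚ
    Σc≡0 = p*q≡0⇒p≡0 _ (1ℚ ℚ.+ 1ℚ) (λ ()) (begin
      sumFin m c ℚ.* (1ℚ ℚ.+ 1ℚ) ≡⟨ ℚₚ.*-comm (sumFin m c) (1ℚ ℚ.+ 1ℚ) ⟩
      (1ℚ ℚ.+ 1ℚ) ℚ.* sumFin m c ≡⟨ sum-*ˡ (1ℚ ℚ.+ 1ℚ) c ⟨
      sumFin m (λ t → (1ℚ ℚ.+ 1ℚ) ℚ.* c t)
        ≡⟨ sum-cong (λ t → trans (ℚₚ.*-comm (1ℚ ℚ.+ 1ℚ) (c t)) (cong (c t ℚ.*_) (sym (dot-edge one (p t))))) ⟩
      dot c (λ t → dot one (points p t)) ≡⟨ dot-combination one c (points p) ⟨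
      dot one (combination c (points p)) ≡⟨ sum-zero (λ k → trans (cong (1ℚ ℚ.*_) (comb≡0 k)) (ℚₚ.*-zeroʳ 1ℚ)) ⟩
      0ℚ ∎)

  independent⇒affine : ∀ {m} (p : Fin m → Edge G) →
                       Independent (points p) → AffinelyIndependent (points p)
  independent⇒affine p ind c _ = ind c

-- Sign vectors of facets

data Sgn : Set where
  neg zer pos : Sgn

opp : Sgn → Sgn
opp neg = pos
opp zer = zer
opp pos = neg

val : Sgn → ℚ
val neg = ℚ.- 1ℚ
val zer = 0ℚ
val pos = 1ℚ

isNeg : Sgn → Bool
isNeg neg = true
isNeg zer = false
isNeg pos = false

isNeg⇒≡ : ∀ s → isNeg s ≡ true → s ≡ neg
isNeg⇒≡ neg _ = refl

neg? : ∀ s → Dec (s ≡ neg)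
neg? neg = yes refl
neg? zer = no λ ()
neg? pos = no λ ()

sgn-ext : ∀ s s′ → isNeg s ≡ isNeg s′ → (s ≡ pos → s′ ≡ pos) → (s′ ≡ pos → s ≡ pos) → s ≡ s′
sgn-ext neg neg _ _ _ = refl
sgn-ext zer zer _ _ _ = refl
sgn-ext zer pos _ _ g = g refl
sgn-ext pos zer _ f _ = sym (f refl)
sgn-ext pos pos _ _ _ = refl

val-opp : ∀ s s′ → val s ℚ.+ val s′ ≡ 0ℚ → s ≡ opp s′
val-opp neg neg ()
val-opp neg zer ()
val-opp neg pos _ = refl
val-opp zer neg ()
val-opp zer zer _ = refl
val-opp zer pos ()
val-opp pos neg _ = refl
val-opp pos zer ()
val-opp pos pos ()

opp-val : ∀ s → val (opp s) ℚ.+ val s ≡ 0ℚ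
opp-val neg = refl
opp-val zer = refl
opp-val pos = refl

neg-balance : ∀ s → 0ℚ ℚ.≤ val neg ℚ.+ val s → s ≡ pos
neg-balance neg (ℚ.*≤* ())
neg-balance zer (ℚ.*≤* ())
neg-balance pos _ = refl

-- σ encodes the functional 1_{σ = pos} − 1_{σ = neg} defining a facet.
record SignVector {n} (G : Graph n) (σ : Fin n → Sgn) : Set where
  field
    neg-edge : ∀ {i j} → adj G i j ≡ true → σ i ≡ neg → σ j ≡ pos
    pos-edge : ∀ {i j} → σ j ≡ pos → σ i ≢ zer → i ≢ j → ∃ λ l → adj G l j ≡ true × σ l ≡ neg
    support  : ∃ λ i → σ i ≢ zer
open SignVector

module _ {n} {G : Graph n} {σ σ′ : Fin n → Sgn} (S : SignVector G σ) (S′ : SignVector G σ′)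
         (same : ∀ i → isNeg (σ i) ≡ isNeg (σ′ i)) where

  -- The negative vertex `a` is the second support vertex that `pos-edge` asks for. It yields a
  -- negative neighbour of `j`, which stays negative under `σ′` and so forces `j` to be positive
  -- there.
  pos-transfer : (∃ λ a → σ a ≡ neg) → ∀ j → σ j ≡ pos → σ′ j ≡ pos
  pos-transfer (a , σa≡neg) j σj≡pos =
    let l , lj , σl≡neg = pos-edge S {a} {j} σj≡pos
          (λ σa≡zer → contradiction (trans (sym σa≡neg) σa≡zer) λ ())
          (λ { refl → contradiction (trans (sym σa≡neg) σj≡pos) λ () })
    in neg-edge S′ lj (isNeg⇒≡ (σ′ l) (trans (sym (same l)) (cong isNeg σl≡neg)))

module _ {n} {G : Graph n} {σ : Fin n → Sgn} (S : SignVector G σ) where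

  support-pos : ¬ (∃ λ a → σ a ≡ neg) → ∀ i → σ i ≢ zer → σ i ≡ pos
  support-pos ∄neg i σi≢zer with σ i in eq
  ... | neg = contradiction (i , eq) ∄neg
  ... | zer = contradiction refl σi≢zer
  ... | pos = refl

  -- Two distinct support vertices would give a negative vertex by `pos-edge`. This is the case of
  -- empty `T`, where the functional is a single coordinate.
  support-unique : ¬ (∃ λ a → σ a ≡ neg) → ∀ i j → σ i ≢ zer → σ j ≢ zer → i ≡ j
  support-unique ∄neg i j σi≢zer σj≢zer = decidable-stable (i ≟ j) λ i≢j →
    let l , _ , σl≡neg = pos-edge S (support-pos ∄neg j σj≢zer) σi≢zer i≢j
    in ∄neg (l , σl≡neg)

module _ {n} {G : Graph n} {σ σ′ : Fin n → Sgn} (S : SignVector G σ) (S′ : SignVector G σ′) where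

  neg-determines : (∃ λ a → σ a ≡ neg) → (∀ i → isNeg (σ i) ≡ isNeg (σ′ i)) → ∀ i → σ i ≡ σ′ i
  neg-determines (a , σa≡neg) same i = sgn-ext (σ i) (σ′ i) (same i)
    (pos-transfer S S′ same (a , σa≡neg) i)
    (pos-transfer S′ S (sym ∘ same)
      (a , isNeg⇒≡ (σ′ a) (trans (sym (same a)) (cong isNeg σa≡neg))) i)

  support-determines : ¬ (∃ λ a → σ a ≡ neg) → ¬ (∃ λ a → σ′ a ≡ neg) →
                       proj₁ (support S) ≡ proj₁ (support S′) → ∀ i → σ i ≡ σ′ i
  support-determines ∄neg ∄neg′ eq i with σ i in p | σ′ i in q
  ... | neg | _   = contradiction (i , p) ∄neg
  ... | zer | neg = contradiction (i , q) ∄neg′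
  ... | pos | neg = contradiction (i , q) ∄neg′
  ... | zer | zer = refl
  ... | pos | pos = refl
  ... | pos | zer = contradiction
    (subst (λ k → σ′ k ≢ zer)
      (trans (sym eq) (sym (support-unique S ∄neg i _ (λ r → contradiction (trans (sym p) r) λ ()) (proj₂ (support S)))))
      (proj₂ (support S′))) (λ ≢zer → ≢zer q)
  ... | zer | pos = contradiction
    (subst (λ k → σ k ≢ zer)
      (trans eq (sym (support-unique S′ ∄neg′ i _ (λ r → contradiction (trans (sym q) r) λ ()) (proj₂ (support S′)))))
      (proj₂ (support S))) (λ ≢zer → ≢zer p)

-- From facet functionals to sign vectors

module _ {n} (G : Graph n) (c : Point n) where

  Nonnegative : Set
  Nonnegative = ∀ i j → adj G i j ≡ true → 0ℚ ℚ.≤ c i ℚ.+ c j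

  TightBalanced : Point n → Set
  TightBalanced x = ∀ i j → adj G i j ≡ true → c i ℚ.+ c j ≡ 0ℚ → x i ℚ.+ x j ≡ 0ℚ

  -- A division-free way to say that the tight edges determine `c` up to scaling. Only vectors
  -- vanishing wherever `c` does are compared, so that fixing `c zero ≡ 0ℚ` can remove the extra
  -- dimension of the bipartite case.
  Rigid : Set
  Rigid = ∀ k → c k ≢ 0ℚ → ∀ x → TightBalanced x → (∀ i → c i ≡ 0ℚ → x i ≡ 0ℚ) →
          x k ≡ 0ℚ → ∀ l → x l ≡ 0ℚ

module _ {n} (G : Graph n) (c : Point n) (nonneg : Nonnegative G c) (rigid : Rigid G c)
  (k : Fin n) (ck≢0 : c k ≢ 0ℚ) where

  private
    t = ∣ c k ∣

    t≢0 : t ≢ 0ℚ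
    t≢0 = ck≢0 ∘ ℚₚ.∣p∣≡0⇒p≡0 (c k)

    instance
      t-pos : ℚ.Positive t
      t-pos = ℚₚ.nonNeg∧nonZero⇒pos t
        where instance
          _ = ℚₚ.∣-∣-nonNeg (c k)
          _ = ℚ.≢-nonZero t≢0

    -- The masked vector vanishes at `k`, so rigidity makes it zero everywhere: each entry of `c` is
    -- `0`, `t` or `- t`.
    mask : ℚ → ℚ
    mask q with ∣ q ∣ ℚₚ.≟ t
    ... | yes _ = 0ℚ
    ... | no  _ = q

    -- Entries at the two ends of a tight edge are opposite, so they have the same absolute value
    -- and are erased or kept together.
    mask-balanced : ∀ p q → p ℚ.+ q ≡ 0ℚ → mask p ℚ.+ mask q ≡ 0ℚ
    mask-balanced p q p+q≡0 with ∣ p ∣ ℚₚ.≟ t | ∣ q ∣ ℚₚ.≟ t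
    ... | yes _  | yes _  = refl
    ... | no _   | no _   = p+q≡0
    ... | yes eq | no neq = contradiction (trans (sym ∣p∣≡∣q∣) eq) neq
      where ∣p∣≡∣q∣ = trans (cong ∣_∣ (inverseˡ-unique p q p+q≡0)) (ℚₚ.∣-p∣≡∣p∣ q)
    ... | no neq | yes eq = contradiction (trans ∣p∣≡∣q∣ eq) neq
      where ∣p∣≡∣q∣ = trans (cong ∣_∣ (inverseˡ-unique p q p+q≡0)) (ℚₚ.∣-p∣≡∣p∣ q)

    mask-zero : mask 0ℚ ≡ 0ℚ
    mask-zero with ∣ 0ℚ ∣ ℚₚ.≟ t
    ... | yes _ = refl
    ... | no  _ = refl

    mask-t : ∀ q → ∣ q ∣ ≡ t → mask q ≡ 0ℚ
    mask-t q eq with ∣ q ∣ ℚₚ.≟ t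
    ... | yes _  = refl
    ... | no neq = contradiction eq neq

    mask≡0 : ∀ q → mask q ≡ 0ℚ → ∣ q ∣ ≡ t ⊎ q ≡ 0ℚ
    mask≡0 q eq with ∣ q ∣ ℚₚ.≟ t
    ... | yes r = inj₁ r
    ... | no  _ = inj₂ eq

  -- Erasing the entries of absolute value t keeps c orthogonal to the tight edges.
  entry : ∀ l → ∃ λ s → c l ≡ t ℚ.* val s
  entry l with mask≡0 (c l) (rigid k ck≢0 (mask ∘ c) (λ i j _ → mask-balanced (c i) (c j))
                 (λ i ci≡0 → trans (cong mask ci≡0) mask-zero) (mask-t (c k) refl) l)
  ... | inj₂ cl≡0 = zer , trans cl≡0 (sym (ℚₚ.*-zeroʳ t))
  ... | inj₁ eq with ℚₚ.∣p∣≡p∨∣p∣≡-p (c l)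
  ...   | inj₁ r = pos , trans (trans (sym r) eq) (sym (ℚₚ.*-identityʳ t))
  ...   | inj₂ r = neg , trans (trans (sym (⁻¹-involutive (c l))) (cong ℚ.-_ (trans (sym r) eq)))
                               (solve 1 (λ a → :- a := a :* con (ℚ.- 1ℚ)) refl t)

  sign : Fin n → Sgn
  sign l = proj₁ (entry l)

  private
    entry-sum : ∀ i j → c i ℚ.+ c j ≡ t ℚ.* (val (sign i) ℚ.+ val (sign j))
    entry-sum i j = trans (cong₂ ℚ._+_ (proj₂ (entry i)) (proj₂ (entry j)))
                          (sym (ℚₚ.*-distribˡ-+ t (val (sign i)) (val (sign j))))

  sign-tight : ∀ i j → c i ℚ.+ c j ≡ 0ℚ ⇔ sign i ≡ opp (sign j)
  sign-tight i j = mk⇔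
    (λ eq → val-opp (sign i) (sign j) (p*q≡0⇒p≡0 (val (sign i) ℚ.+ val (sign j)) t t≢0
      (trans (ℚₚ.*-comm (val (sign i) ℚ.+ val (sign j)) t) (trans (sym (entry-sum i j)) eq))))
    (λ eq → trans (entry-sum i j)
      (trans (cong (t ℚ.*_) (trans (cong (λ s → val s ℚ.+ val (sign j)) eq) (opp-val (sign j))))
             (ℚₚ.*-zeroʳ t)))

  private
    tight⇒opp : ∀ i j → c i ℚ.+ c j ≡ 0ℚ → sign i ≡ opp (sign j)
    tight⇒opp i j = Equivalence.to (sign-tight i j)

    sign≢zer : ∀ i → sign i ≢ zer → c i ≢ 0ℚ
    sign≢zer i s≢zer ci≡0 = s≢zer (val≡0 (sign i) (p*q≡0⇒p≡0 (val (sign i)) t t≢0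
      (trans (ℚₚ.*-comm (val (sign i)) t) (trans (sym (proj₂ (entry i))) ci≡0))))
      where
      val≡0 : ∀ s → val s ≡ 0ℚ → s ≡ zer
      val≡0 zer _ = refl

  sign-zer : ∀ i → c i ≡ 0ℚ → sign i ≡ zer
  sign-zer i ci≡0 with sign i in eq
  ... | zer = refl
  ... | neg = contradiction ci≡0 (sign≢zer i λ r → contradiction (trans (sym eq) r) λ ())
  ... | pos = contradiction ci≡0 (sign≢zer i λ r → contradiction (trans (sym eq) r) λ ())

  private
    find-neg : ∀ {i j} → sign j ≡ pos → sign i ≢ zer → i ≢ j →
               ∃ λ l → adj G l j ≡ true × sign l ≡ neg
    find-neg {i} {j} sj≡pos si≢zer i≢j
      with any? (λ l → (adj G l j 𝔹ₚ.≟ true) ×-dec neg? (sign l))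
    ... | yes found = found
    -- Otherwise no tight edge meets j, so the indicator of j is proportional to c.
    ... | no ∄neg = contradiction (trans (sym (indicator-refl j))
        (rigid i (sign≢zer i si≢zer) (indicator j) balanced
          (λ l cl≡0 → indicator-≢ j l λ { refl → cj≢0 cl≡0 })
          (indicator-≢ j i (i≢j ∘ sym)) j)) λ ()
      where
      cj≢0 : c j ≢ 0ℚ
      cj≢0 = sign≢zer j λ r → contradiction (trans (sym sj≡pos) r) λ ()
      opp-pos : ∀ {a} → c j ℚ.+ c a ≡ 0ℚ → sign a ≡ neg
      opp-pos {a} eq = trans (tight⇒opp a j (trans (ℚₚ.+-comm (c a) (c j)) eq)) (cong opp sj≡pos)
      balanced : TightBalanced G c (indicator j)
      balanced a b ab eq = cong₂ ℚ._+_
        (indicator-≢ j a λ { refl → ∄neg (b , trans (symmetric G b a) ab , opp-pos eq) })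
        (indicator-≢ j b λ { refl → ∄neg (a , ab , opp-pos (trans (ℚₚ.+-comm (c b) (c a)) eq)) })

  signVector : SignVector G sign
  signVector = record
    { neg-edge = λ {i} {j} ij si≡neg → neg-balance (sign j)
        (subst (λ s → 0ℚ ℚ.≤ val s ℚ.+ val (sign j)) si≡neg
          (ℚₚ.*-cancelˡ-≤-pos t (subst₂ ℚ._≤_ (sym (ℚₚ.*-zeroʳ t)) (entry-sum i j) (nonneg i j ij))))
    ; pos-edge = find-neg
    ; support  = k , λ sk≡zer → ck≢0 (trans (proj₂ (entry k))
                       (trans (cong (λ s → t ℚ.* val s) sk≡zer) (ℚₚ.*-zeroʳ t)))
    }

-- Counting facets by codes

AllPairs-lookup : ∀ {A : Set} {R : A → A → Set} {xs : List A} → AllPairs R xs →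
                  ∀ {i j} → i Fin.< j → R (lookup xs i) (lookup xs j)
AllPairs-lookup {xs = _ ∷ xs} (rs AllPairs.∷ _)  {zero}  {suc j} _         = All.lookup rs (∈-lookup j)
AllPairs-lookup               (_  AllPairs.∷ rs) {suc i} {suc j} (s≤s i<j) = AllPairs-lookup rs i<j

distinct-length : ∀ {A : Set} {_~_ : A → A → Set} {N} (x₀ : Fin (suc N)) (code : A → Fin (suc N)) →
                  (∀ a → x₀ ≢ code a) → (∀ a b → code a ≡ code b → a ~ b) →
                  ∀ xs → AllPairs (λ a b → ¬ a ~ b) xs → length xs ≤ N
distinct-length x₀ code avoid inj xs distinct = ℕₚ.≮⇒≥ λ N<length →
  let i , j , i<j , eq = pigeonhole N<length (λ i → punchOut (avoid (lookup xs i)))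
  in AllPairs-lookup distinct i<j
       (inj _ _ (punchOut-injective (avoid (lookup xs i)) (avoid (lookup xs j)) eq))

bit : Bool → Fin 2
bit b = if b then suc zero else zero

bit-injective : ∀ {a b} → bit a ≡ bit b → a ≡ b
bit-injective {true}  {true}  _ = refl
bit-injective {false} {false} _ = refl

subsetCode : ∀ {m} → (Fin m → Bool) → Fin (2 ^ m)
subsetCode f = funToFin (bit ∘ f)

subsetCode-injective : ∀ {m} (f g : Fin m → Bool) → subsetCode f ≡ subsetCode g → ∀ i → f i ≡ g i
subsetCode-injective f g eq i = bit-injective (begin
  bit (f i)                    ≡⟨ finToFun-funToFin (bit ∘ f) i ⟨
  finToFun (subsetCode f) i    ≡⟨ cong (λ c → finToFun c i) eq ⟩
  finToFun (subsetCode g) i    ≡⟨ finToFun-funToFin (bit ∘ g) i ⟩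
  bit (g i) ∎)
  where open ≡-Reasoning

join-injective : ∀ m n {x y} → join m n x ≡ join m n y → x ≡ y
join-injective m n {x} {y} eq =
  trans (sym (splitAt-join m n x)) (trans (cong (Fin.splitAt m) eq) (splitAt-join m n y))

-- The form in which a facet is recovered from its sign vector: facets sharing `σ` have the same
-- tight edges.
SignPattern : ∀ {n d} {G : Graph n} → Facet G d → (Fin n → Sgn) → Set
SignPattern F σ = ∀ e → Tight F e ⇔ σ (proj₁ (proj₁ e)) ≡ opp (σ (proj₂ (proj₁ e)))

module Count {n d} {G : Graph n} (Q : (Fin n → Sgn) → Set)
  (represent : (F : Facet G d) → ∃ λ σ → SignVector G σ × Q σ × SignPattern F σ)
  (encode : (Fin n → Bool) → Fin (2 ^ d))
  (encode-injective : ∀ {σ σ′} → SignVector G σ → SignVector G σ′ → Q σ → Q σ′ →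
     encode (isNeg ∘ σ) ≡ encode (isNeg ∘ σ′) → ∀ i → isNeg (σ i) ≡ isNeg (σ′ i))
  (x₀ : Fin (2 ^ d))
  (encode-avoids : ∀ {σ} → SignVector G σ → Q σ → (∃ λ a → σ a ≡ neg) → x₀ ≢ encode (isNeg ∘ σ))
  (vertex : Fin n → Fin (suc d))
  (vertex-injective : ∀ {σ σ′ i j} → Q σ → Q σ′ → σ i ≢ zer → σ′ j ≢ zer → vertex i ≡ vertex j → i ≡ j)
  where

  private
    hasNeg? : (σ : Fin n → Sgn) → Dec (∃ λ a → σ a ≡ neg)
    hasNeg? σ = any? (neg? ∘ σ)

    code′ : ∀ {σ} → SignVector G σ → Dec (∃ λ a → σ a ≡ neg) → Fin (2 ^ d) ⊎ Fin (suc d)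
    code′ {σ} S (yes _) = inj₁ (encode (isNeg ∘ σ))
    code′ S (no _)      = inj₂ (vertex (proj₁ (support S)))

    avoids : ∀ {σ} (S : SignVector G σ) → Q σ → ∀ dec → inj₁ x₀ ≢ code′ S dec
    avoids S q (yes has) eq = encode-avoids S q has (inj₁-injective eq)

    determines : ∀ {σ σ′} (S : SignVector G σ) (S′ : SignVector G σ′) → Q σ → Q σ′ →
                 ∀ dec dec′ → code′ S dec ≡ code′ S′ dec′ → ∀ i → σ i ≡ σ′ i
    determines S S′ q q′ (yes has) (yes _) eq =
      neg-determines S S′ has (encode-injective S S′ q q′ (inj₁-injective eq))
    determines S S′ q q′ (no ∄neg) (no ∄neg′) eq = support-determines S S′ ∄neg ∄neg′
      (vertex-injective q q′ (proj₂ (support S)) (proj₂ (support S′)) (inj₂-injective eq))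

    code : Facet G d → Fin (2 ^ d + suc d)
    code F = let σ , S , _ = represent F in join (2 ^ d) (suc d) (code′ S (hasNeg? σ))

    code-avoids : ∀ F → join (2 ^ d) (suc d) (inj₁ x₀) ≢ code F
    code-avoids F eq = let σ , S , q , _ = represent F in
      avoids S q (hasNeg? σ) (join-injective (2 ^ d) (suc d) eq)

    code-determines : ∀ F F′ → code F ≡ code F′ → SameFacet F F′
    code-determines F F′ eq e = let
        σ  , S  , q  , tight  = represent F
        σ′ , S′ , q′ , tight′ = represent F′
        same = determines S S′ q q′ (hasNeg? σ) (hasNeg? σ′) (join-injective (2 ^ d) (suc d) eq)
        i = proj₁ (proj₁ e)
        j = proj₂ (proj₁ e)
      in mk⇔
        (λ t → Equivalence.from (tight′ e)
          (trans (sym (same i)) (trans (Equivalence.to (tight e) t) (cong opp (same j)))))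
        (λ t → Equivalence.from (tight e)
          (trans (same i) (trans (Equivalence.to (tight′ e) t) (sym (cong opp (same j))))))

  facets-length : (fs : List (Facet G d)) → DistinctFacets fs → length fs ≤ 2 ^ d + d
  facets-length = distinct-length (cast (join (2 ^ d) (suc d) (inj₁ x₀))) (cast ∘ code)
    (λ F → code-avoids F ∘ cast-injective) (λ F F′ → code-determines F F′ ∘ cast-injective)
    where
    cast : Fin (2 ^ d + suc d) → Fin (suc (2 ^ d + d))
    cast = subst Fin (ℕₚ.+-suc (2 ^ d) d)
    cast-injective : ∀ {x y} → cast x ≡ cast y → x ≡ y
    cast-injective = subst-injective (ℕₚ.+-suc (2 ^ d) d)

-- The upper bound


Balanced : ∀ {n} → Graph n → Point n → Set
Balanced G x = ∀ i j → adj G i j ≡ true → x i ℚ.+ x j ≡ 0ℚ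

-- A balanced vector only changes sign along an edge, so a zero spreads along paths. Hence balanced
-- vectors form a space of dimension at most one.
balanced-zero : ∀ {n} {G : Graph n} (x : Point n) → Connected G → Balanced G x →
                ∀ i → x i ≡ 0ℚ → ∀ j → x j ≡ 0ℚ
balanced-zero {G = G} x conn bal i xi≡0 j = spread (conn i j) xi≡0
  where
  spread : ∀ {i j} → Reach G i j → x i ≡ 0ℚ → x j ≡ 0ℚ
  spread here xi≡0 = xi≡0
  spread (step {i = i} {j = j} ij r) xi≡0 = spread r (trans (sym (ℚₚ.+-identityˡ (x j)))
    (trans (cong (ℚ._+ x j) (sym xi≡0)) (bal i j ij)))

-- The instance of `independent-∷` for edge points. The two families involved agree only after a
-- case split on the index.
independent-edge : ∀ {n m} {G : Graph n} (p : Fin m → Edge G) → Independent (points {G = G} p) →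
  (x : Point n) → (∀ t → dot x (points {G = G} p t) ≡ 0ℚ) →
  (e : Edge G) → x (proj₁ (proj₁ e)) ℚ.+ x (proj₂ (proj₁ e)) ≢ 0ℚ → Independent (points {G = G} (e ∷ᵛ p))
independent-edge {n} {m} {G} p ind x x⊥p e xe≢0 c comb≡0 =
  independent-∷ (points {G = G} p) x (edgePoint {G = G} e) ind x⊥p (xe≢0 ∘ trans (sym (dot-edge {G = G} x e))) c
    λ k → trans (sum-cong {suc m} {λ t → c t ℚ.* (edgePoint {G = G} e ∷ᵛ points {G = G} p) t k}
                          {λ t → c t ℚ.* points {G = G} (e ∷ᵛ p) t k}
                  λ { zero → refl ; (suc t) → refl })
                (comb≡0 k)

-- Writing the dimension as `suc d-1` lets the `d ∸ 1` in `facetDim` reduce, so that a facet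
-- supplies exactly `d` independent edge points.
module Upper {n d-1} {G : Graph n} (conn : Connected G) (dim : EdgePolytopeDim G (suc d-1)) where

  private
    d = suc d-1

  basis : Fin (suc d) → Edge G
  basis = proj₁ (proj₁ dim)

  basis-independent : Independent (points {G = G} basis)
  basis-independent = affine⇒independent {G = G} basis (proj₂ (proj₂ (proj₁ dim)))

  -- An edge on which `x` does not vanish could be adjoined to the basis, exceeding the dimension.
  orthogonal⇒balanced : ∀ x → (∀ t → dot x (points {G = G} basis t) ≡ 0ℚ) → Balanced G x
  orthogonal⇒balanced x x⊥ i j ij = decidable-stable (x i ℚ.+ x j ℚₚ.≟ 0ℚ) λ ≢0 →
    let extended : Fin (suc (suc d)) → Edge G
        extended = ((i , j) , ij) ∷ᵛ basis
        ind = independent-edge {G = G} basis basis-independent x x⊥ ((i , j) , ij) ≢0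
    in proj₂ dim (extended , (λ _ → tt) , independent⇒affine {G = G} extended ind)

  module Potential (F : Facet G d) where

    raw : Point n
    raw i = ½ ℚ.* b F ℚ.+ ℚ.- a F i

    -- Kept as a property, not tied to `raw`, because the bipartite case shifts `raw` by a balanced
    -- vector, which leaves all edge sums unchanged.
    Slack : Point n → Set
    Slack c = ∀ (e : Edge G) →
      c (proj₁ (proj₁ e)) ℚ.+ c (proj₂ (proj₁ e)) ≡ b F ℚ.- dot (a F) (edgePoint {G = G} e)

    raw-slack : Slack raw
    raw-slack e@((i , j) , _) = trans
      (solve 3 (λ b x y → (con ½ :* b :+ :- x) :+ (con ½ :* b :+ :- y) := b :+ :- (x :+ y)) refl
        (b F) (a F i) (a F j))
      (cong (λ z → b F ℚ.- z) (sym (dot-edge {G = G} (a F) e)))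

    module Representative (c : Point n) (slack : Slack c) where

      tight-slack : ∀ e → Tight F e ⇔ c (proj₁ (proj₁ e)) ℚ.+ c (proj₂ (proj₁ e)) ≡ 0ℚ
      tight-slack e = mk⇔
        (λ tight → trans (slack e) (trans (cong (λ z → b F ℚ.- z) tight) (ℚₚ.+-inverseʳ (b F))))
        (λ eq → sym (x∙y⁻¹≈ε⇒x≈y (b F) (dot (a F) (edgePoint {G = G} e)) (trans (sym (slack e)) eq)))

      slack-nonneg : Nonnegative G c
      slack-nonneg i j ij = subst (0ℚ ℚ.≤_) (sym (slack e))
        (subst (ℚ._≤ b F ℚ.- v) (ℚₚ.+-inverseʳ v) (ℚₚ.+-monoˡ-≤ (ℚ.- v) (valid F e)))
        where
        e : Edge G
        e = (i , j) , ij
        v = dot (a F) (edgePoint {G = G} e)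

      -- If `c` were zero, every edge would be tight, and the `d + 1` edges of `basis` would lie in
      -- a face of dimension `d - 1`.
      nonzero : ∃ λ k → c k ≢ 0ℚ
      nonzero with any? (λ k → ¬? (c k ℚₚ.≟ 0ℚ))
      ... | yes found = found
      ... | no ∄ = contradiction (basis , (λ t → Equivalence.from (tight-slack (basis t))
                                            (cong₂ ℚ._+_ (zeros (proj₁ (proj₁ (basis t)))) (zeros (proj₂ (proj₁ (basis t))))))
                                        , proj₂ (proj₂ (proj₁ dim)))
                                 (proj₂ (facetDim F))
        where
        zeros : ∀ k → c k ≡ 0ℚ
        zeros k = decidable-stable (c k ℚₚ.≟ 0ℚ) λ ≢0 → ∄ (k , ≢0)

      facetBasis : Fin d → Edge G
      facetBasis = proj₁ (proj₁ (facetDim F))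

      facetBasis-independent : Independent (points {G = G} facetBasis)
      facetBasis-independent = affine⇒independent {G = G} facetBasis (proj₂ (proj₂ (proj₁ (facetDim F))))

      facetBasis-tight : ∀ t → c (proj₁ (proj₁ (facetBasis t))) ℚ.+ c (proj₂ (proj₁ (facetBasis t))) ≡ 0ℚ
      facetBasis-tight t = Equivalence.to (tight-slack (facetBasis t)) (proj₁ (proj₂ (proj₁ (facetDim F))) t)

      tight⊥facetBasis : ∀ x → TightBalanced G c x → ∀ t → dot x (points {G = G} facetBasis t) ≡ 0ℚ
      tight⊥facetBasis x bal t = trans (dot-edge {G = G} x (facetBasis t))
        (bal _ _ (proj₂ (facetBasis t)) (facetBasis-tight t))

      pattern-of : Rigid G c → (Q : (Fin n → Sgn) → Set) →
          (∀ {σ} → (∀ i → c i ≡ 0ℚ → σ i ≡ zer) → Q σ) →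
          ∃ λ σ → SignVector G σ × Q σ × SignPattern F σ
      pattern-of rigid Q q = let k , ck≢0 = nonzero in
        sign G c slack-nonneg rigid k ck≢0 , signVector G c slack-nonneg rigid k ck≢0 ,
        q (sign-zer G c slack-nonneg rigid k ck≢0) ,
        λ e@((i , j) , _) → mk⇔
          (Equivalence.to (sign-tight G c slack-nonneg rigid k ck≢0 i j) ∘ Equivalence.to (tight-slack e))
          (Equivalence.from (tight-slack e) ∘ Equivalence.from (sign-tight G c slack-nonneg rigid k ck≢0 i j))

-- The non-bipartite case: d + 1 vertices

xor-cancel : ∀ p q r s → p xor q ≡ r xor s → q ≡ s → p ≡ r
xor-cancel false false false false _ _ = refl
xor-cancel false true  false true  _ _ = refl
xor-cancel true  false true  false _ _ = refl
xor-cancel true  true  true  true  _ _ = refl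

xor-complement : ∀ p q r s → p xor q ≡ r xor s → q ≢ s → p ≡ not r
xor-complement _ false _ false _ q≢s = contradiction refl q≢s
xor-complement _ true  _ true  _ q≢s = contradiction refl q≢s
xor-complement false false false true () _
xor-complement false false true  true _  _ = refl
xor-complement true  false false true _  _ = refl
xor-complement true  false true  true () _
xor-complement false true false false () _
xor-complement false true true  false _  _ = refl
xor-complement true  true false false _  _ = refl
xor-complement true  true true  false () _

xor-false : ∀ p q → false ≡ p xor q → p ≡ q
xor-false false false _ = refl
xor-false true  true  _ = refl

module _ {n} {G : Graph n} {σ : Fin n → Sgn} (S : SignVector G σ) where

  neg-independent : ∀ {i j} → adj G i j ≡ true → isNeg (σ i) ≡ true → isNeg (σ j) ≡ true → ∀ {A : Set} → A
  neg-independent {i} {j} ij ni nj =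
    contradiction (trans (sym (isNeg⇒≡ (σ j) nj)) (neg-edge S ij (isNeg⇒≡ (σ i) ni))) λ ()

upper-nonbipartite : ∀ {d-1} (G : Graph (suc (suc d-1))) → Connected G → EdgePolytopeDim G (suc d-1) →
  (fs : List (Facet G (suc d-1))) → DistinctFacets fs → length fs ≤ 2 ^ suc d-1 + suc d-1
upper-nonbipartite {d-1} G conn dim = Count.facets-length (λ _ → ⊤) represent encode
    encode-injective (subsetCode (λ (_ : Fin (suc d-1)) → false)) encode-avoids (λ i → i) (λ _ _ _ _ eq → eq)
  where
  open Upper conn dim
  d = suc d-1
  n = suc d

  -- Adding the bit of vertex `zero` identifies a set with its complement, so `d` bits suffice for
  -- `d + 1` vertices.
  normalise : (Fin n → Bool) → Fin d → Bool
  normalise T i = T (suc i) xor T zero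

  encode : (Fin n → Bool) → Fin (2 ^ d)
  encode T = subsetCode (normalise T)

  represent : (F : Facet G d) → ∃ λ σ → SignVector G σ × ⊤ × SignPattern F σ
  represent F = pattern-of
    -- The `d` facet edges are orthogonal to `raw` in dimension `d + 1`, so their orthogonal
    -- complement is the line through `raw`.
    (λ k ck≢0 x bal _ → orthogonal-line (points {G = G} facetBasis) ℕₚ.≤-refl
      facetBasis-independent raw
      (λ t → trans (dot-edge {G = G} raw (facetBasis t)) (facetBasis-tight t))
      k ck≢0 x (tight⊥facetBasis x bal)) (λ _ → ⊤) _
    where
    open Potential F
    open Representative raw raw-slack

  -- The `d + 1` basis edges span the whole space, so only zero is orthogonal to them all.
  not-bipartite : ∀ x → Balanced G x → x zero ≡ 0ℚ
  not-bipartite x bal = independent-basis (points {G = G} basis) ℕₚ.≤-refl basis-independent x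
    (λ t → trans (dot-edge {G = G} x (basis t)) (bal _ _ (proj₂ (basis t)))) zero

  -- Both negative sets are independent, so if they were complementary they would form a
  -- bipartition, and the vector with values `1` and `-1` on its sides would be balanced.
  complement : ∀ {σ σ′} → SignVector G σ → SignVector G σ′ →
               ¬ (∀ i → isNeg (σ i) ≡ not (isNeg (σ′ i)))
  complement {σ} {σ′} S S′ compl = two≢0 (isNeg (σ zero)) (not-bipartite x bal)
    where
    ± : Bool → ℚ
    ± s = if s then 1ℚ else ℚ.- 1ℚ
    x : Point n
    x i = ± (isNeg (σ i))
    two≢0 : ∀ s → ± s ≢ 0ℚ
    two≢0 true  ()
    two≢0 false ()
    bal : Balanced G x
    bal i j ij with isNeg (σ i) in p | isNeg (σ j) in q
    ... | true  | false = refl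
    ... | false | true  = refl
    ... | true  | true  = neg-independent S ij p q
    ... | false | false = neg-independent S′ ij
      (𝔹ₚ.not-injective (trans (sym (compl i)) p)) (𝔹ₚ.not-injective (trans (sym (compl j)) q))

  -- Equal codes mean equal or complementary negative sets, according to vertex `zero`; `complement`
  -- excludes the second.
  encode-injective : ∀ {σ σ′} → SignVector G σ → SignVector G σ′ → ⊤ → ⊤ →
    encode (isNeg ∘ σ) ≡ encode (isNeg ∘ σ′) → ∀ i → isNeg (σ i) ≡ isNeg (σ′ i)
  encode-injective {σ} {σ′} S S′ _ _ eq with isNeg (σ zero) 𝔹ₚ.≟ isNeg (σ′ zero)
  ... | yes same = λ { zero → same ; (suc i) → xor-cancel (isNeg (σ (suc i))) _ (isNeg (σ′ (suc i))) _ (codes i) same }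
    where codes = subsetCode-injective (normalise (isNeg ∘ σ)) (normalise (isNeg ∘ σ′)) eq
  ... | no differ = contradiction
      (λ { zero → 𝔹ₚ.¬-not differ ; (suc i) → xor-complement (isNeg (σ (suc i))) _ (isNeg (σ′ (suc i))) _ (codes i) differ })
      (complement S S′)
    where codes = subsetCode-injective (normalise (isNeg ∘ σ)) (normalise (isNeg ∘ σ′)) eq

  -- The zero code stands for the empty set and the full vertex set. The former does not contain
  -- `a`; the latter would contain both ends of an edge at `a`.
  encode-avoids : ∀ {σ} → SignVector G σ → ⊤ → (∃ λ a → σ a ≡ neg) →
                  subsetCode (λ (_ : Fin d) → false) ≢ encode (isNeg ∘ σ)
  encode-avoids {σ} S _ (a , σa≡neg) eq =
    let j , aj = noIsolated G a
    in neg-independent S aj (cong isNeg σa≡neg) (trans (constant j) (trans (sym (constant a)) (cong isNeg σa≡neg)))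
    where
    constant : ∀ i → isNeg (σ i) ≡ isNeg (σ zero)
    constant zero    = refl
    constant (suc i) = xor-false (isNeg (σ (suc i))) (isNeg (σ zero))
      (subsetCode-injective (λ _ → false) (normalise (isNeg ∘ σ)) eq i)

-- The bipartite case: d + 2 vertices

upper-bipartite : ∀ {d-1} (G : Graph (suc (suc (suc d-1)))) → Connected G → EdgePolytopeDim G (suc d-1) →
  (fs : List (Facet G (suc d-1))) → DistinctFacets fs → length fs ≤ 2 ^ suc d-1 + suc d-1
upper-bipartite {d-1} G conn dim = Count.facets-length Q represent encode
    encode-injective (subsetCode (λ (_ : Fin (suc d-1)) → false)) encode-avoids vertex
    (λ {σ} {σ′} {i} {j} → vertex-injective {σ} {σ′} i j)
  where
  open Upper conn dim
  d = suc d-1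
  n = suc (suc d)

  Q : (Fin n → Sgn) → Set
  Q σ = σ zero ≡ zer

  solution = nontrivialSolution (ℕₚ.n<1+n (suc d)) (points {G = G} basis)

  -- The bipartition functional up to scaling: a nonzero solution of the `d + 1` equations of the
  -- basis edges in `d + 2` unknowns.
  ε : Point n
  ε = proj₁ solution

  ε-balanced : Balanced G ε
  ε-balanced = orthogonal⇒balanced ε (proj₂ (proj₂ solution))

  ε₀≢0 : ε zero ≢ 0ℚ
  ε₀≢0 eq = let j , εj≢0 = proj₁ (proj₂ solution) in
    εj≢0 (balanced-zero {G = G} ε conn ε-balanced zero eq j)

  instance _ = ℚ.≢-nonZero ε₀≢0

  represent : (F : Facet G d) → ∃ λ σ → SignVector G σ × Q σ × SignPattern F σ
  represent F = Representative.pattern-of c slack rigid Q (λ zeros → zeros zero c₀≡0)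
    where
    open Potential F
    s : ℚ
    s = ℚ.- (raw zero ℚ.* 1/ ε zero)
    c : Point n
    c i = raw i ℚ.+ s ℚ.* ε i
    c₀≡0 : c zero ≡ 0ℚ
    c₀≡0 = trans
      (solve 3 (λ r u e → r :+ :- (r :* u) :* e := r :* (con 1ℚ :+ :- (u :* e))) refl
        (raw zero) (1/ ε zero) (ε zero))
      (trans (cong (λ z → raw zero ℚ.* (1ℚ ℚ.+ ℚ.- z)) (ℚₚ.*-inverseˡ (ε zero))) (ℚₚ.*-zeroʳ (raw zero)))
    slack : Slack c
    slack e@((i , j) , ij) = trans
      (solve 5 (λ r r′ s e e′ → (r :+ s :* e) :+ (r′ :+ s :* e′) := (r :+ r′) :+ s :* (e :+ e′)) refl
        (raw i) (raw j) s (ε i) (ε j))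
      (trans (cong (λ z → raw i ℚ.+ raw j ℚ.+ s ℚ.* z) (ε-balanced i j ij))
        (trans (cong (raw i ℚ.+ raw j ℚ.+_) (ℚₚ.*-zeroʳ s))
          (trans (ℚₚ.+-identityʳ (raw i ℚ.+ raw j)) (raw-slack e))))
    open Representative c slack
    -- The facet edges leave a plane containing `ε` and `c`. Adjoining `indicator zero`, which `ε`
    -- separates from them, cuts it down to the line through `c`; `x` is orthogonal to it because
    -- `x` vanishes where `c` does.
    w : Fin (suc d) → Point n
    w = indicator zero ∷ᵛ points {G = G} facetBasis
    rigid : Rigid G c
    rigid k ck≢0 x bal supp = orthogonal-line w ℕₚ.≤-refl
      (independent-∷ (points {G = G} facetBasis) ε (indicator zero) facetBasis-independent
        (λ t → trans (dot-edge {G = G} ε (facetBasis t)) (ε-balanced _ _ (proj₂ (facetBasis t))))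
        (ε₀≢0 ∘ trans (sym (dot-indicator ε zero))))
      c (λ { zero → trans (dot-indicator c zero) c₀≡0
           ; (suc t) → tight⊥facetBasis c (λ _ _ _ eq → eq) t })
      k ck≢0 x
      (λ { zero → trans (dot-indicator x zero) (supp zero c₀≡0)
         ; (suc t) → tight⊥facetBasis x bal t })

  neighbour : ∃ λ w → adj G zero (suc w) ≡ true
  neighbour with noIsolated G zero
  ... | zero  , loop = contradiction (trans (sym loop) (loopless G zero)) λ ()
  ... | suc w , 0w = w , 0w

  w = proj₁ neighbour

  -- A negative neighbour would make vertex `zero` positive. So neither `zero` nor `suc w` needs a
  -- bit, and `d` of the `d + 2` vertices remain.
  w-nonneg : ∀ {σ} → SignVector G σ → Q σ → isNeg (σ (suc w)) ≡ false
  w-nonneg {σ} S σ₀≡zer with σ (suc w) in eq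
  ... | zer = refl
  ... | pos = refl
  ... | neg = contradiction
    (trans (sym (neg-edge S (trans (symmetric G (suc w) zero) (proj₂ neighbour)) eq)) σ₀≡zer) λ ()

  restrict : (Fin n → Bool) → Fin d → Bool
  restrict T i = T (suc (punchIn w i))

  encode : (Fin n → Bool) → Fin (2 ^ d)
  encode T = subsetCode (restrict T)

  agree : (T T′ : Fin n → Bool) → T zero ≡ T′ zero → T (suc w) ≡ T′ (suc w) →
          (∀ i → T (suc (punchIn w i)) ≡ T′ (suc (punchIn w i))) → ∀ i → T i ≡ T′ i
  agree T T′ p q r zero = p
  agree T T′ p q r (suc i) with w ≟ i
  ... | yes refl = q
  ... | no w≢i   = subst (λ i → T (suc i) ≡ T′ (suc i)) (punchIn-punchOut w≢i) (r (punchOut w≢i))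

  encode-injective : ∀ {σ σ′} → SignVector G σ → SignVector G σ′ → Q σ → Q σ′ →
    encode (isNeg ∘ σ) ≡ encode (isNeg ∘ σ′) → ∀ i → isNeg (σ i) ≡ isNeg (σ′ i)
  encode-injective {σ} {σ′} S S′ q q′ eq = agree (isNeg ∘ σ) (isNeg ∘ σ′)
    (cong isNeg (trans q (sym q′))) (trans (w-nonneg S q) (sym (w-nonneg S′ q′)))
    (subsetCode-injective (restrict (isNeg ∘ σ)) (restrict (isNeg ∘ σ′)) eq)

  encode-avoids : ∀ {σ} → SignVector G σ → Q σ → (∃ λ a → σ a ≡ neg) →
                  subsetCode (λ (_ : Fin d) → false) ≢ encode (isNeg ∘ σ)
  encode-avoids {σ} S q (a , σa≡neg) eq = contradiction
    (trans (agree (λ _ → false) (isNeg ∘ σ) (sym (cong isNeg q)) (sym (w-nonneg S q))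
             (subsetCode-injective (λ _ → false) (restrict (isNeg ∘ σ)) eq) a) (cong isNeg σa≡neg)) λ ()

  -- The value at `zero` is a default shared with `suc zero`; the collision is harmless since `Q`
  -- keeps `zero` out of the support.
  vertex : Fin n → Fin (suc d)
  vertex zero    = zero
  vertex (suc i) = i

  vertex-injective : ∀ {σ σ′} i j → Q σ → Q σ′ → σ i ≢ zer → σ′ j ≢ zer → vertex i ≡ vertex j → i ≡ j
  vertex-injective zero    _       q _  σ≢ _   _    = contradiction q σ≢
  vertex-injective (suc _) zero    _ q′ _  σ′≢ _    = contradiction q′ σ′≢
  vertex-injective (suc _) (suc _) _ _  _  _   refl = refl

-- The number of vertices

vertex-bound : ∀ {n d-1} (G : Graph n) → Connected G → EdgePolytopeDim G (suc d-1) → n ≤ suc (suc (suc d-1))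
vertex-bound {zero} _ _ _ = z≤n
vertex-bound {suc n} {d-1} G conn dim = ℕₚ.≮⇒≥ absurd
  where
  open Upper conn dim
  w : Fin (suc (suc (suc d-1))) → Point (suc n)
  w = indicator zero ∷ᵛ points {G = G} basis
  absurd : ¬ (suc (suc (suc d-1)) < suc n)
  -- With more than `d + 2` vertices some nonzero balanced vector would vanish at `zero`, against
  -- connectedness.
  absurd big = let x , (j , xj≢0) , x⊥ = nontrivialSolution big w in
    xj≢0 (balanced-zero {G = G} x conn (orthogonal⇒balanced x (x⊥ ∘ suc)) zero
           (trans (sym (dot-indicator x zero)) (x⊥ zero)) j)

-- Bipartiteness is never tested: the vertex number, `d + 1` or `d + 2`, tells the two cases apart.
upper-bound : ∀ {n d-1} → suc (suc d-1) ≤ n → n ≤ suc (suc (suc d-1)) →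
  (G : Graph n) → Connected G → EdgePolytopeDim G (suc d-1) →
  (fs : List (Facet G (suc d-1))) → DistinctFacets fs → length fs ≤ 2 ^ suc d-1 + suc d-1
upper-bound lower upper with ℕₚ.m≤n⇒m<n∨m≡n lower
... | inj₂ refl = upper-nonbipartite
... | inj₁ lower′ with ℕₚ.≤-antisym lower′ upper
...   | refl = upper-bipartite

-- The lower bound

-- Converse direction: if `c` is nonnegative on edges and its tight edges determine it up to
-- scaling, they span a facet, here on `d + 1` vertices.
module FromFunctional {d-1} (G : Graph (suc (suc d-1))) (c : Point (suc (suc d-1)))
  (nonneg : Nonnegative G c)
  (k : Fin (suc (suc d-1))) (ck≢0 : c k ≢ 0ℚ)
  (line : ∀ x → x k ≡ 0ℚ → TightBalanced G c x → ∀ l → x l ≡ 0ℚ) where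

  private
    d n : ℕ
    d = suc d-1
    n = suc d

    Zero : Edge G → Set
    Zero e = c (proj₁ (proj₁ e)) ℚ.+ c (proj₂ (proj₁ e)) ≡ 0ℚ

    -- The contrapositive of `line`, made constructive by a search through the finitely many edges.
    separating : ∀ x → x k ≡ 0ℚ → (∃ λ l → x l ≢ 0ℚ) →
      ∃ λ e → Zero e × x (proj₁ (proj₁ e)) ℚ.+ x (proj₂ (proj₁ e)) ≢ 0ℚ
    separating x xk≡0 (l , xl≢0) with any? (λ i → any? (λ j →
        (adj G i j 𝔹ₚ.≟ true) ×-dec (c i ℚ.+ c j ℚₚ.≟ 0ℚ) ×-dec ¬? (x i ℚ.+ x j ℚₚ.≟ 0ℚ)))
    ... | yes (i , j , ij , tight , ≢0) = ((i , j) , ij) , tight , ≢0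
    ... | no ∄ = contradiction
      (line x xk≡0 (λ i j ij tight → decidable-stable (x i ℚ.+ x j ℚₚ.≟ 0ℚ)
        λ ≢0 → ∄ (i , j , ij , tight , ≢0)) l) xl≢0

    -- While fewer than d independent tight edges are found, some functional
    -- vanishing on them and at k is not a multiple of c.
    greedy : ∀ m → m ≤ d → Σ (Fin m → Edge G) λ p → (∀ t → Zero (p t)) × Independent (points {G = G} p)
    greedy zero    _   = (λ ()) , (λ ()) , λ _ _ ()
    greedy (suc m) m<d =
      let p , tight , ind = greedy m (ℕₚ.<⇒≤ m<d)
          w : Fin (suc m) → Point n
          w = indicator k ∷ᵛ points {G = G} p
          x , x≢0 , x⊥ = nontrivialSolution (s≤s m<d) w
          xk≡0 : x k ≡ 0ℚ
          xk≡0 = trans (sym (dot-indicator x k)) (x⊥ zero)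
          e , zero-e , xe≢0 = separating x xk≡0 x≢0
      in e ∷ᵛ p , (λ { zero → zero-e ; (suc t) → tight t }) ,
         independent-edge {G = G} p ind x (x⊥ ∘ suc) e xe≢0

    -c : Point n
    -c i = ℚ.- c i

    dot-neg : ∀ e → dot -c (edgePoint {G = G} e) ≡ ℚ.- (c (proj₁ (proj₁ e)) ℚ.+ c (proj₂ (proj₁ e)))
    dot-neg e = trans (dot-edge {G = G} -c e) (sym (ℚₚ.neg-distrib-+ (c (proj₁ (proj₁ e))) (c (proj₂ (proj₁ e)))))

    tight⇒zero : ∀ e → dot -c (edgePoint {G = G} e) ≡ 0ℚ → Zero e
    tight⇒zero e eq = ℚₚ.neg-injective (trans (sym (dot-neg e)) eq)

  facet : Facet G d
  facet = record
    { a = -c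
    ; b = 0ℚ
    ; valid = λ e → ℚₚ.≤-trans (ℚₚ.≤-reflexive (dot-neg e)) (ℚₚ.neg-antimono-≤ (nonneg _ _ (proj₂ e)))
    ; facetDim =
        (let p , tight , ind = greedy d ℕₚ.≤-refl in
         p , (λ t → trans (dot-neg (p t)) (cong ℚ.-_ (tight t))) , independent⇒affine {G = G} p ind) ,
        -- Here `d + 1` independent tight edges would span the whole space and force `c` to vanish.
        λ (p , tight , aff) → ck≢0 (independent-basis (points {G = G} p) ℕₚ.≤-refl
          (affine⇒independent {G = G} p aff) c
          (λ t → trans (dot-edge {G = G} c (p t)) (tight⇒zero (p t) (tight t))) k)
    }

  facet-tight : ∀ e → Tight facet e ⇔ c (proj₁ (proj₁ e)) ℚ.+ c (proj₂ (proj₁ e)) ≡ 0ℚ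
  facet-tight e = mk⇔ (tight⇒zero e) (λ eq → trans (dot-neg e) (cong ℚ.-_ eq))

  -- An edge off the facet is independent of the `d` tight edges, as `c` vanishes on those and not
  -- on it. The `d + 1` vertices bound the rank from above.
  dimension : (e : Edge G) → c (proj₁ (proj₁ e)) ℚ.+ c (proj₂ (proj₁ e)) ≢ 0ℚ → EdgePolytopeDim G d
  dimension e ce≢0 =
    (let p , tight , ind = greedy d ℕₚ.≤-refl in
     e ∷ᵛ p , (λ _ → tt) , independent⇒affine {G = G} (e ∷ᵛ p)
       (independent-edge {G = G} p ind c (λ t → trans (dot-edge {G = G} c (p t)) (tight t)) e ce≢0)) ,
    λ (p , _ , aff) → ℕₚ.<⇒≱ (ℕₚ.n<1+n n)
      (independent⇒≤ (points {G = G} p) (affine⇒independent {G = G} p aff))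

-- The windmill graph

data Vertex (m r : ℕ) : Set where
  hub  : Vertex m r
  blk  : Fin m → Fin 3 → Vertex m r
  leaf : Fin r → Vertex m r

-- m copies of K₄ sharing the vertex hub, which also carries r pendant edges.
module Windmill (m r : ℕ) where

  n : ℕ
  n = suc (m ℕ.* 3 + r)

  index : Vertex m r → Fin n
  index hub       = zero
  index (blk b a) = suc (combine b a ↑ˡ r)
  index (leaf l)  = suc ((m ℕ.* 3) ↑ʳ l)

  view : Fin n → Vertex m r
  view zero    = hub
  view (suc i) = [ uncurry blk ∘ remQuot 3 , leaf ]′ (splitAt (m ℕ.* 3) i)

  view-index : ∀ v → view (index v) ≡ v
  view-index hub       = refl
  view-index (blk b a) = trans
    (cong [ uncurry blk ∘ remQuot 3 , leaf ]′ (splitAt-↑ˡ (m ℕ.* 3) (combine b a) r))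
    (cong (uncurry blk) (remQuot-combine b a))
  view-index (leaf l)  = cong [ uncurry blk ∘ remQuot 3 , leaf ]′ (splitAt-↑ʳ (m ℕ.* 3) r l)

  index-view : ∀ i → index (view i) ≡ i
  index-view zero    = refl
  index-view (suc i) with splitAt (m ℕ.* 3) i in eq
  ... | inj₁ x = cong suc (trans (cong (_↑ˡ r) (combine-remQuot {m} 3 x))
    (trans (cong (join (m ℕ.* 3) r) (sym eq)) (join-splitAt (m ℕ.* 3) r i)))
  ... | inj₂ y = cong suc (trans (cong (join (m ℕ.* 3) r) (sym eq)) (join-splitAt (m ℕ.* 3) r i))

  adjacent : Vertex m r → Vertex m r → Bool
  adjacent hub        hub          = false
  adjacent hub        _            = true
  adjacent _          hub          = true
  adjacent (blk b a)  (blk b′ a′)  = does (b ≟ b′) ∧ not (does (a ≟ a′))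
  adjacent _          _            = false

  adjacent-sym : ∀ v w → adjacent v w ≡ adjacent w v
  adjacent-sym hub       hub         = refl
  adjacent-sym hub       (blk _ _)   = refl
  adjacent-sym hub       (leaf _)    = refl
  adjacent-sym (blk _ _) hub         = refl
  adjacent-sym (blk b a) (blk b′ a′) = cong₂ (λ p q → p ∧ not q) (does-sym b b′) (does-sym a a′)
    where
    does-sym : ∀ {n} (i j : Fin n) → does (i ≟ j) ≡ does (j ≟ i)
    does-sym i j with i ≟ j | j ≟ i
    ... | yes _   | yes _   = refl
    ... | no _    | no _    = refl
    ... | yes i≡j | no j≢i  = contradiction (sym i≡j) j≢i
    ... | no i≢j  | yes j≡i = contradiction (sym j≡i) i≢j
  adjacent-sym (blk _ _) (leaf _)    = refl
  adjacent-sym (leaf _)  hub         = refl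
  adjacent-sym (leaf _)  (blk _ _)   = refl
  adjacent-sym (leaf _)  (leaf _)    = refl

  adjacent-irrefl : ∀ v → adjacent v v ≡ false
  adjacent-irrefl hub       = refl
  adjacent-irrefl (leaf _)  = refl
  adjacent-irrefl (blk b a) with b ≟ b | a ≟ a
  ... | _     | no a≢a = contradiction refl a≢a
  ... | yes _ | yes _  = refl
  ... | no _  | yes _  = refl

  adjacent-blk : ∀ {b a b′ a′} → adjacent (blk b a) (blk b′ a′) ≡ true → b ≡ b′ × a ≢ a′
  adjacent-blk {b} {a} {b′} {a′} eq with b ≟ b′ | a ≟ a′
  ... | yes b≡b′ | no a≢a′ = b≡b′ , a≢a′

  blk-adjacent : ∀ b {a a′} → a ≢ a′ → adjacent (blk b a) (blk b a′) ≡ true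
  blk-adjacent b {a} {a′} a≢a′ with b ≟ b | a ≟ a′
  ... | yes _ | no _    = refl
  ... | yes _ | yes a≡  = contradiction a≡ a≢a′
  ... | no b≢b | _      = contradiction refl b≢b

-- The values −1, 1, 0 on a block whose vertex t is negative (suc t), or which is
-- not met by the negative set at all (zero).
blockValue : Fin 4 → Fin 3 → ℚ
blockValue zero    a = 0ℚ
blockValue (suc t) a = if does (t ≟ a) then ℚ.- 1ℚ else 1ℚ

blockValue-hub : ∀ s a → 0ℚ ℚ.≤ 1ℚ ℚ.+ blockValue s a
blockValue-hub zero    a = ℚ.*≤* (ℤ.+≤+ z≤n)
blockValue-hub (suc t) a with does (t ≟ a)
... | true  = ℚ.*≤* (ℤ.+≤+ z≤n)
... | false = ℚ.*≤* (ℤ.+≤+ z≤n)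

blockValue-edge : ∀ s {a a′} → a ≢ a′ → 0ℚ ℚ.≤ blockValue s a ℚ.+ blockValue s a′
blockValue-edge zero    _ = ℚ.*≤* (ℤ.+≤+ z≤n)
blockValue-edge (suc t) {a} {a′} a≢a′ with t ≟ a | t ≟ a′
... | yes refl | yes refl = contradiction refl a≢a′
... | yes _    | no _     = ℚ.*≤* (ℤ.+≤+ z≤n)
... | no _     | yes _    = ℚ.*≤* (ℤ.+≤+ z≤n)
... | no _     | no _     = ℚ.*≤* (ℤ.+≤+ z≤n)

blockValue-self : ∀ t → blockValue (suc t) t ≡ ℚ.- 1ℚ
blockValue-self t with t ≟ t
... | yes _  = refl
... | no t≢t = contradiction refl t≢t

blockValue-other : ∀ {t a} → t ≢ a → blockValue (suc t) a ≡ 1ℚ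
blockValue-other {t} {a} t≢a with t ≟ a
... | yes t≡a = contradiction t≡a t≢a
... | no _    = refl

-- Makes the choice in a block readable from the facet: a hub edge into the block is tight only at
-- the negative vertex.
blockValue-tight : ∀ s a → 1ℚ ℚ.+ blockValue s a ≡ 0ℚ → s ≡ suc a
blockValue-tight (suc t) a eq with t ≟ a
... | yes refl = refl

+-zeroʳ⁻ : ∀ p q → p ≡ 0ℚ → p ℚ.+ q ≡ 0ℚ → q ≡ 0ℚ
+-zeroʳ⁻ p q refl eq = trans (sym (ℚₚ.+-identityˡ q)) eq

-- A triangle is an odd cycle: each entry is half of the sum of its two edge values minus the
-- opposite one.
triangle-zero : (x : Fin 3 → ℚ) → (∀ {a a′} → a ≢ a′ → x a ℚ.+ x a′ ≡ 0ℚ) → ∀ a → x a ≡ 0ℚ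
triangle-zero x bal = λ
  { zero             → solved zero (suc zero) (suc (suc zero)) (λ ()) (λ ()) (λ ())
  ; (suc zero)       → solved (suc zero) zero (suc (suc zero)) (λ ()) (λ ()) (λ ())
  ; (suc (suc zero)) → solved (suc (suc zero)) zero (suc zero) (λ ()) (λ ()) (λ ()) }
  where
  solved : ∀ i j l → i ≢ j → i ≢ l → j ≢ l → x i ≡ 0ℚ
  solved i j l i≢j i≢l j≢l = trans
    (solve 3 (λ x y z → x := con ½ :* ((x :+ y) :+ (x :+ z) :+ :- (y :+ z))) refl (x i) (x j) (x l))
    (cong (½ ℚ.*_) (cong₂ (λ p q → p ℚ.+ ℚ.- q) (cong₂ ℚ._+_ (bal i≢j) (bal i≢l)) (bal j≢l)))

-- Facets of the windmill

module Facets (m-1 r : ℕ) where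

  -- At least one block is present. It supplies a neighbour of the hub and the edges that tell
  -- `Star` from every `Choice`.
  m = suc m-1
  open Windmill m r

  neighbour : Vertex m r → Vertex m r
  neighbour hub = blk zero zero
  neighbour _   = hub

  neighbour-adjacent : ∀ v → adjacent v (neighbour v) ≡ true
  neighbour-adjacent hub       = refl
  neighbour-adjacent (blk _ _) = refl
  neighbour-adjacent (leaf _)  = refl

  G : Graph n
  G = record
    { adj        = λ i j → adjacent (view i) (view j)
    ; symmetric  = λ i j → adjacent-sym (view i) (view j)
    ; loopless   = λ i → adjacent-irrefl (view i)
    ; noIsolated = λ i → index (neighbour (view i)) ,
        trans (cong (adjacent (view i)) (view-index _)) (neighbour-adjacent (view i))
    }

  connected : Connected G
  connected i j = to-hub (from-hub j)
    where
    from-hub : ∀ j → Reach G zero j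
    from-hub j with view j in eq
    ... | hub     = subst (Reach G zero) (trans (cong index (sym eq)) (index-view j)) here
    ... | blk _ _ = step (cong (adjacent hub) eq) here
    ... | leaf _  = step (cong (adjacent hub) eq) here
    to-hub : ∀ {j} → Reach G zero j → Reach G i j
    to-hub with view i in eq
    ... | hub     = subst (λ i → Reach G i _) (trans (cong index (sym eq)) (index-view i))
    ... | blk _ _ = step (cong (λ v → adjacent v hub) eq)
    ... | leaf _  = step (cong (λ v → adjacent v hub) eq)

  edge : ∀ v w → adjacent v w ≡ true → Edge G
  edge v w vw = (index v , index w) , trans (cong₂ adjacent (view-index v) (view-index w)) vw

  module FromVertexFunctional (c : Vertex m r → ℚ)
    (nonneg : ∀ v w → adjacent v w ≡ true → 0ℚ ℚ.≤ c v ℚ.+ c w)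
    (c-hub≢0 : c hub ≢ 0ℚ)
    (line : ∀ (x : Vertex m r → ℚ) → x hub ≡ 0ℚ →
            (∀ v w → adjacent v w ≡ true → c v ℚ.+ c w ≡ 0ℚ → x v ℚ.+ x w ≡ 0ℚ) → ∀ v → x v ≡ 0ℚ) where

    open FromFunctional G (c ∘ view) (λ i j → nonneg (view i) (view j)) zero c-hub≢0
      (λ x x₀≡0 bal l → trans (cong x (sym (index-view l)))
        (line (x ∘ index) x₀≡0 (λ v w vw cvw → bal (index v) (index w) (proj₂ (edge v w vw))
          (trans (cong₂ (λ v w → c v ℚ.+ c w) (view-index v) (view-index w)) cvw)) (view l)))
      public using (facet; facet-tight; dimension)

    facet-edge : ∀ v w (vw : adjacent v w ≡ true) → Tight facet (edge v w vw) ⇔ c v ℚ.+ c w ≡ 0ℚ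
    facet-edge v w vw = subst (λ q → Tight facet (edge v w vw) ⇔ q ≡ 0ℚ)
      (cong₂ (λ v w → c v ℚ.+ c w) (view-index v) (view-index w)) (facet-tight (edge v w vw))

  -- The case where `T` consists of the hub: the tight edges are exactly the spanning star at the
  -- hub.
  module Star where

    c : Vertex m r → ℚ
    c hub = ℚ.- 1ℚ
    c _   = 1ℚ

    nonneg : ∀ v w → adjacent v w ≡ true → 0ℚ ℚ.≤ c v ℚ.+ c w
    nonneg hub       (blk _ _) _ = ℚ.*≤* (ℤ.+≤+ z≤n)
    nonneg hub       (leaf _)  _ = ℚ.*≤* (ℤ.+≤+ z≤n)
    nonneg (blk _ _) hub       _ = ℚ.*≤* (ℤ.+≤+ z≤n)
    nonneg (blk _ _) (blk _ _) _ = ℚ.*≤* (ℤ.+≤+ z≤n)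
    nonneg (leaf _)  hub       _ = ℚ.*≤* (ℤ.+≤+ z≤n)

    line : ∀ (x : Vertex m r → ℚ) → x hub ≡ 0ℚ →
           (∀ v w → adjacent v w ≡ true → c v ℚ.+ c w ≡ 0ℚ → x v ℚ.+ x w ≡ 0ℚ) → ∀ v → x v ≡ 0ℚ
    line x xh bal hub       = xh
    line x xh bal (blk b a) = +-zeroʳ⁻ (x hub) (x (blk b a)) xh (bal hub (blk b a) refl refl)
    line x xh bal (leaf l)  = +-zeroʳ⁻ (x hub) (x (leaf l)) xh (bal hub (leaf l) refl refl)

    open FromVertexFunctional c nonneg (λ ()) line public

  -- `T` consists of all leaves and the chosen block vertices. If `r` is zero and `f` is constantly
  -- `zero`, then `T` is empty and the functional is the hub coordinate.
  module Choice (f : Fin m → Fin 4) where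

    c : Vertex m r → ℚ
    c hub       = 1ℚ
    c (blk b a) = blockValue (f b) a
    c (leaf _)  = ℚ.- 1ℚ

    nonneg : ∀ v w → adjacent v w ≡ true → 0ℚ ℚ.≤ c v ℚ.+ c w
    nonneg hub       (blk b a) _ = blockValue-hub (f b) a
    nonneg hub       (leaf _)  _ = ℚ.*≤* (ℤ.+≤+ z≤n)
    nonneg (blk b a) hub       _ = subst (0ℚ ℚ.≤_) (ℚₚ.+-comm 1ℚ (blockValue (f b) a)) (blockValue-hub (f b) a)
    nonneg (blk b a) (blk b′ a′) e with adjacent-blk {b} {a} {b′} {a′} e
    ... | refl , a≢a′ = blockValue-edge (f b) a≢a′
    nonneg (leaf _)  hub       _ = ℚ.*≤* (ℤ.+≤+ z≤n)

    -- The zero at the hub spreads along tight edges to the leaves and to each chosen vertex, and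
    -- from there to the rest of its block. A block without a chosen vertex has slack hub edges, but
    -- its triangle is tight.
    line : ∀ (x : Vertex m r → ℚ) → x hub ≡ 0ℚ →
           (∀ v w → adjacent v w ≡ true → c v ℚ.+ c w ≡ 0ℚ → x v ℚ.+ x w ≡ 0ℚ) → ∀ v → x v ≡ 0ℚ
    line x xh bal hub       = xh
    line x xh bal (leaf l)  = +-zeroʳ⁻ (x hub) (x (leaf l)) xh (bal hub (leaf l) refl refl)
    line x xh bal (blk b a) with f b in fb
    ... | zero  = triangle-zero (x ∘ blk b) (λ {a} {a′} a≢a′ →
      bal (blk b a) (blk b a′) (blk-adjacent b a≢a′)
          (cong (λ s → blockValue s a ℚ.+ blockValue s a′) fb)) a
    ... | suc t with t ≟ a
    ...   | yes refl = +-zeroʳ⁻ (x hub) (x (blk b a)) xh (bal hub (blk b a) refl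
      (cong (1ℚ ℚ.+_) (trans (cong (λ s → blockValue s a) fb) (blockValue-self a))))
    ...   | no t≢a = +-zeroʳ⁻ (x (blk b t)) (x (blk b a)) xt≡0 (bal (blk b t) (blk b a) (blk-adjacent b t≢a)
      (trans (cong (λ s → blockValue s t ℚ.+ blockValue s a) fb)
             (cong₂ ℚ._+_ (blockValue-self t) (blockValue-other t≢a))))
      where
      xt≡0 : x (blk b t) ≡ 0ℚ
      xt≡0 = +-zeroʳ⁻ (x hub) (x (blk b t)) xh (bal hub (blk b t) refl
        (cong (1ℚ ℚ.+_) (trans (cong (λ s → blockValue s t) fb) (blockValue-self t))))

    open FromVertexFunctional c nonneg (λ ()) line public

  choice-transfer : ∀ f g → SameFacet (Choice.facet f) (Choice.facet g) → ∀ b a → f b ≡ suc a → g b ≡ suc a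
  choice-transfer f g same b a fb = blockValue-tight (g b) a
    (Equivalence.to (Choice.facet-edge g hub (blk b a) refl)
      (Equivalence.to (same (edge hub (blk b a) refl))
        (Equivalence.from (Choice.facet-edge f hub (blk b a) refl)
          (cong (1ℚ ℚ.+_) (trans (cong (λ s → blockValue s a) fb) (blockValue-self a))))))

  choice-injective : ∀ f g → SameFacet (Choice.facet f) (Choice.facet g) → ∀ b → f b ≡ g b
  choice-injective f g same b with f b in fb | g b in gb
  ... | zero  | zero  = refl
  ... | suc a | _     = trans (sym (choice-transfer f g same b a fb)) gb
  ... | zero  | suc a = trans (sym fb)
    (choice-transfer g f (λ e → mk⇔ (Equivalence.from (same e)) (Equivalence.to (same e))) b a gb)

  -- The star is tight on all three hub edges of a block, a choice on at most one.
  star≢choice : ∀ f → ¬ SameFacet Star.facet (Choice.facet f)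
  star≢choice f same = contradiction (trans (sym (chosen zero)) (chosen (suc zero))) λ ()
    where
    chosen : ∀ a → f zero ≡ suc a
    chosen a = blockValue-tight (f zero) a
      (Equivalence.to (Choice.facet-edge f hub (blk zero a) refl)
        (Equivalence.to (same (edge hub (blk zero a) refl))
          (Equivalence.from (Star.facet-edge hub (blk zero a) refl) refl)))

  d : ℕ
  d = m ℕ.* 3 + r

  polytope-dim : EdgePolytopeDim G d
  -- An edge inside a block has value 2 under the star functional, so it lies off that facet.
  polytope-dim = Star.dimension (edge (blk zero zero) (blk zero (suc zero)) refl) (λ ())

  facets : List (Facet G d)
  facets = Star.facet ∷ tabulate (λ i → Choice.facet (finToFun {4} {m} i))

  facets-distinct : DistinctFacets facets
  facets-distinct = Allₚ.tabulate⁺ (λ i → star≢choice (finToFun i)) AllPairs.∷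
    tabulate⁺ (λ {i} {j} i≢j same → i≢j (finToFun-injective i j
      (choice-injective (finToFun i) (finToFun j) same)))
    where
    funToFin-cong : ∀ {k l} {f g : Fin k → Fin l} → (∀ i → f i ≡ g i) → funToFin f ≡ funToFin g
    funToFin-cong {zero}  eq = refl
    funToFin-cong {suc k} eq = cong₂ combine (eq zero) (funToFin-cong (eq ∘ suc))
    finToFun-injective : ∀ (i j : Fin (4 ^ m)) → (∀ b → finToFun {4} {m} i b ≡ finToFun j b) → i ≡ j
    finToFun-injective i j eq = trans (sym (funToFin-finToFin {m} {4} i))
      (trans (funToFin-cong eq) (funToFin-finToFin {m} {4} j))

  facets-length : length facets ≡ suc (4 ^ m)
  facets-length = cong suc (length-tabulate _)

LowerBound : ℕ → ℕ → Set
LowerBound N d = Σ ℕ (λ n → Σ (Graph n) (λ G → Connected G × EdgePolytopeDim G d ×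
  Σ (List (Facet G d)) (λ fs → DistinctFacets fs × N < length fs)))

windmill-bound : ∀ m-1 r → LowerBound (4 ^ suc m-1) (suc m-1 ℕ.* 3 + r)
windmill-bound m-1 r = n , G , connected , polytope-dim , facets , facets-distinct ,
  ℕₚ.≤-reflexive (sym facets-length)
  where
  open Facets m-1 r
  open Windmill (suc m-1) r using (n)

lower-bound : ∀ d → 3 ≤ d → LowerBound (4 ^ (d / 3)) d
-- The positivity of `d / 3` excludes the case `zero`, leaving a windmill with at least one block.
lower-bound d 3≤d with d / 3 | m≥n⇒m/n>0 3≤d | m≡m%n+[m/n]*n d 3
... | suc q | _ | eq = subst (LowerBound (4 ^ suc q))
  (trans (ℕₚ.+-comm (suc q ℕ.* 3) (d % 3)) (sym eq))
  (windmill-bound q (d % 3))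

theorem5p4 : (d : ℕ) → 3 ≤ d →
    ((n : ℕ) (G : Graph n) → Connected G → EdgePolytopeDim G d →
    (fs : List (Facet G d)) → DistinctFacets fs → length fs ≤ 2 ^ d + d)
    × Σ ℕ (λ n → Σ (Graph n) (λ G → Connected G × EdgePolytopeDim G d ×
    Σ (List (Facet G d)) (λ fs → DistinctFacets fs × 4 ^ (d / 3) < length fs)))
theorem5p4 d@(suc _) 3≤d =
  (λ n G conn dim → upper-bound
    -- The `d + 1` independent basis edge points give the lower bound on the number of vertices.
    (independent⇒≤ (points {G = G} (Upper.basis conn dim)) (Upper.basis-independent conn dim))
    (vertex-bound G conn dim) G conn dim) ,
  lower-bound d 3≤d
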